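{- For each integer $N\ge 2$ define real numbers $R_N(N),R_N(N-1),\dots,R_N(1)$ by backward recursion: $$R_N(N)=\frac{N+1}{2},$$ and for $r=N-1,N-2,\dots,1$, $$s_r=\Big\lfloor \frac{r+1}{N+1}\,R_N(r+1)\Big\rfloor,\qquad R_N(r)=\Big(\frac{s_r}{r}\Big)^2\cdot\frac{N+1}{r+1}\cdot\frac{s_r+1}{2}+\Big(1-\Big(\frac{s_r}{r}\Big)^2\Big)R_N(r+1).$$ Then $$\lim_{N\to\infty}\frac{R_N(1)}{\sqrt N}=1.$$
   Context: Interpretation (not needed for the formal statement): in the noncooperative two-sided secretary game, each player dates at most $N$ partners, one per round, and in round $N$ must marry. The rank of each new date relative to the partners already seen is uniform on $\{1,\dots,r\}$ in round $r$, independently for the two sides. A player in round $r$ proposes iff the observed rank of the current date is at most the threshold $s_r$ (subgame perfect equilibrium threshold), and marriage occurs iff both propose. $R_N(r)$ is the expected rank (among the $N$ partners that would be seen in a full game) of the eventual mate for a player entering round $r$ under this equilibrium. The theorem concerns $R_N(1)$, the expected such rank on entering the game. -}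

module Defs where

open import Data.Nat as ℕ using (ℕ; zero; suc; _∸_)
open import Data.Integer as ℤ using (ℤ; +_)
open import Data.Rational using (ℚ; _/_; _+_; _*_; _-_; floor; 1ℚ)

-- One backward step of the recursion: given r ≥ 1 and x = R_N(r+1),
-- returns R_N(r).  (The case r = 0 never occurs for 1 ≤ r ≤ N-1.)
--   s_r  = ⌊ (r+1)/(N+1) · R_N(r+1) ⌋
--   R_N(r) = (s_r/r)^2 · (N+1)/(r+1) · (s_r+1)/2 + (1 - (s_r/r)^2) · R_N(r+1)
threshold : ℕ → ℕ → ℚ → ℤ
threshold N r x = floor (((+ (suc r)) / suc N) * x)

step : ℕ → ℕ → ℚ → ℚ
step N zero x = x
step N (suc r) x =
  let s = threshold N (suc r) x
      q = s / suc r
  in ((q * q) * ((+ (suc N)) / suc (suc r))) * ((s ℤ.+ ℤ.1ℤ) / 2)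
     + (1ℚ - q * q) * x

-- Rfrom N k = R_N(N ∸ k)
Rfrom : ℕ → ℕ → ℚ
Rfrom N zero = (+ (suc N)) / 2
Rfrom N (suc k) = step N (N ∸ suc k) (Rfrom N k)

-- R N r = R_N(r), meaningful for 1 ≤ r ≤ N
R : ℕ → ℕ → ℚ
R N r = Rfrom N (N ∸ r)

{-# OPTIONS --safe #-}

-- Put u_r = R_N(r)/(N+1), v = (r+1)u_{r+1} and s = ⌊v⌋.  The recursion reads
--   2(r+1)r²(u_{r+1} − u_r) = s²(2v − s − 1),
-- and the right-hand side lies between v³ − 2v² and v³.  Hence u_{r+1} − u_r ≈ u_{r+1}³/2,
-- so that 1/u_r² grows by about 1 per step, 1/u_1² ≈ N, and R_N(1) ≈ (N+1)/√N.
-- The errors are controlled by a parameter κ = 1/K: a step contributes at most 1 + 8κ once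
-- r ≥ K and 1/u² ≥ K, at most 8 if r < K and 1/u² ≥ K, and 1/u² ≤ 4K after a step from
-- 1/u² ≤ K; a step contributes at least 1 − 2κ as long as v ≥ K, which holds for
-- r + 1 ≥ κN unless 1/u² already exceeds N ≥ K⁴.
-- Lower bounds 1/u² ≥ B and upper bounds 1/u² ≤ B are written u²B ≤ 1 and 1 ≤ u²B.
module Submission where

open import Defs
open import Data.Nat as ℕ using (ℕ; zero; suc; _≤_; _∸_)
import Data.Nat.Properties as ℕ
open import Data.Integer as ℤ using (ℤ; +_; -[1+_])
import Data.Integer.Properties as ℤ
import Data.Integer.DivMod as ℤ
import Data.Integer.Tactic.RingSolver as ℤ-Solver
open import Data.Rational using (ℚ; mkℚ; _/_; _*_; _-_; _+_; -_; _<_; 0ℚ; 1ℚ; ½; floor; toℚᵘ; positive; nonNegative; *≤*; *<*) renaming (_≤_ to _≤ℚ_)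
open import Data.Rational.Properties
import Data.Rational.Unnormalised as ℚᵘ
import Data.Rational.Unnormalised.Properties as ℚᵘ
open import Data.Product using (∃-syntax; _×_; _,_; proj₁; proj₂)
open import Data.Sum using (_⊎_; inj₁; inj₂)
open import Data.List.Base using (_∷_; [])
open import Relation.Nullary using (yes; no)
open import Relation.Nullary.Decidable using (dec⇒maybe)
open import Relation.Binary.PropositionalEquality
open import Level using (0ℓ)
open import Tactic.RingSolver using (solve)
import Tactic.RingSolver.Core.AlmostCommutativeRing as ACR

-- Integers inside the rationals, and the floor.

ℚ-ring : ACR.AlmostCommutativeRing 0ℓ 0ℓ
ℚ-ring = ACR.fromCommutativeRing +-*-commutativeRing (λ x → dec⇒maybe (0ℚ ≟ x))

ι : ℕ → ℚ
ι n = + n / 1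

toℚᵘ-/ : ∀ i m → toℚᵘ (i / suc m) ℚᵘ.≃ ℚᵘ.mkℚᵘ i m
toℚᵘ-/ i m = toℚᵘ-fromℚᵘ (ℚᵘ.mkℚᵘ i m)

/1-homo-+ : ∀ i j → (i / 1) + (j / 1) ≡ (i ℤ.+ j) / 1
/1-homo-+ i j = toℚᵘ-injective (ℚᵘ.≃-trans (toℚᵘ-homo-+ (i / 1) (j / 1)) (ℚᵘ.≃-trans (ℚᵘ.+-cong (toℚᵘ-/ i 0) (toℚᵘ-/ j 0))
  (ℚᵘ.≃-trans (ℚᵘ.*≡* (cross i j)) (ℚᵘ.≃-sym (toℚᵘ-/ (i ℤ.+ j) 0)))))
  where
  cross : ∀ i j → (i ℤ.* ℤ.1ℤ ℤ.+ j ℤ.* ℤ.1ℤ) ℤ.* ℤ.1ℤ ≡ (i ℤ.+ j) ℤ.* ℤ.1ℤ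
  cross = ℤ-Solver.solve-∀

/-cancel : ∀ i m → (i / suc m) * ι (suc m) ≡ i / 1
/-cancel i m = toℚᵘ-injective (ℚᵘ.≃-trans (toℚᵘ-homo-* (i / suc m) (ι (suc m))) (ℚᵘ.≃-trans (ℚᵘ.*-cong (toℚᵘ-/ i m) (toℚᵘ-/ (+ suc m) 0))
  (ℚᵘ.≃-trans (ℚᵘ.*≡* cross) (ℚᵘ.≃-sym (toℚᵘ-/ i 0)))))
  where
  cross : (i ℤ.* + suc m) ℤ.* ℤ.1ℤ ≡ i ℤ.* (+ (suc m ℕ.* 1))
  cross = trans (ℤ.*-identityʳ _) (cong (λ k → i ℤ.* + k) (sym (ℕ.*-identityʳ (suc m))))

/1-mono-≤ : ∀ {i j} → i ℤ.≤ j → (i / 1) ≤ℚ (j / 1)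
/1-mono-≤ {i} {j} i≤j = toℚᵘ-cancel-≤ (ℚᵘ.≤-respˡ-≃ (ℚᵘ.≃-sym (toℚᵘ-/ i 0)) (ℚᵘ.≤-respʳ-≃ (ℚᵘ.≃-sym (toℚᵘ-/ j 0))
  (ℚᵘ.*≤* (ℤ.*-monoʳ-≤-nonNeg ℤ.1ℤ i≤j))))

ι-mono-≤ : ∀ m n → m ≤ n → ι m ≤ℚ ι n
ι-mono-≤ m n m≤n = /1-mono-≤ (ℤ.+≤+ m≤n)

ι-homo-+ : ∀ m n → ι (m ℕ.+ n) ≡ ι m + ι n
ι-homo-+ m n = sym (/1-homo-+ (+ m) (+ n))

ι-suc : ∀ n → ι (suc n) ≡ ι n + 1ℚ
ι-suc n = trans (ι-homo-+ 1 n) (+-comm 1ℚ (ι n))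

/1-homo-* : ∀ i j → (i / 1) * (j / 1) ≡ (i ℤ.* j) / 1
/1-homo-* i j = toℚᵘ-injective (ℚᵘ.≃-trans (toℚᵘ-homo-* (i / 1) (j / 1)) (ℚᵘ.≃-trans (ℚᵘ.*-cong (toℚᵘ-/ i 0) (toℚᵘ-/ j 0))
  (ℚᵘ.≃-sym (toℚᵘ-/ (i ℤ.* j) 0))))

ι-homo-* : ∀ m n → ι (m ℕ.* n) ≡ ι m * ι n
ι-homo-* m n = trans (cong (_/ 1) (ℤ.pos-* m n)) (sym (/1-homo-* (+ m) (+ n)))

0≤ι : ∀ n → 0ℚ ≤ℚ ι n
0≤ι n = ι-mono-≤ 0 n ℕ.z≤n

1≤ι-suc : ∀ n → 1ℚ ≤ℚ ι (suc n)
1≤ι-suc n = ι-mono-≤ 1 (suc n) (ℕ.s≤s ℕ.z≤n)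

0<ι-suc : ∀ n → 0ℚ < ι (suc n)
0<ι-suc n = <-≤-trans (positive⁻¹ 1ℚ) (1≤ι-suc n)

floor≤ : ∀ p → floor p / 1 ≤ℚ p
floor≤ p@(mkℚ a d _) = toℚᵘ-cancel-≤ (ℚᵘ.≤-respˡ-≃ (ℚᵘ.≃-sym (toℚᵘ-/ (floor p) 0))
  (ℚᵘ.*≤* (ℤ.≤-trans (ℤ.[n/d]*d≤n a (+ suc d)) (ℤ.≤-reflexive (sym (ℤ.*-identityʳ a))))))

≤floor+1 : ∀ p → p ≤ℚ floor p / 1 + 1ℚ
≤floor+1 p@(mkℚ a d _) = subst (p ≤ℚ_) (sym (/1-homo-+ (floor p) ℤ.1ℤ))
  (toℚᵘ-cancel-≤ (ℚᵘ.≤-respʳ-≃ (ℚᵘ.≃-sym (toℚᵘ-/ (floor p ℤ.+ ℤ.1ℤ) 0))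
  (ℚᵘ.*≤* (ℤ.≤-trans (ℤ.≤-reflexive (ℤ.*-identityʳ a)) (ℤ.<⇒≤ (subst (λ k → a ℤ.< k ℤ.* + suc d) (eq (floor p)) below))))))
  where
  below : a ℤ.< ℤ.suc (floor p) ℤ.* + suc d
  below = subst (λ k → a ℤ.< ℤ.suc k ℤ.* + suc d) (sym (ℤ.div-pos-is-/ℕ a (suc d))) (ℤ.n<s[n/ℕd]*d a (suc d))
  eq : ∀ z → ℤ.suc z ≡ z ℤ.+ ℤ.1ℤ
  eq z = ℤ.+-comm ℤ.1ℤ z

0≤floor : ∀ p → 0ℚ ≤ℚ p → ℤ.0ℤ ℤ.≤ floor p
0≤floor p@(mkℚ a d _) (*≤* 0≤p) = ℤ.0≤n⇒0≤n/d a (+ suc d) (subst (ℤ.0ℤ ℤ.≤_) (ℤ.*-identityʳ a) 0≤p) (ℤ.+≤+ ℕ.z≤n)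

-- Order arithmetic on the rationals.

0≤-* : ∀ {p q} → 0ℚ ≤ℚ p → 0ℚ ≤ℚ q → 0ℚ ≤ℚ p * q
0≤-* {p} {q} 0≤p 0≤q = nonNegative⁻¹ (p * q) {{nonNeg*nonNeg⇒nonNeg p {{nonNegative 0≤p}} q {{nonNegative 0≤q}}}}

0≤-+ : ∀ {p q} → 0ℚ ≤ℚ p → 0ℚ ≤ℚ q → 0ℚ ≤ℚ p + q
0≤-+ = +-mono-≤ {0ℚ} {_} {0ℚ}

p≤q⇒0≤q-p : ∀ {p q} → p ≤ℚ q → 0ℚ ≤ℚ q - p
p≤q⇒0≤q-p {p} {q} p≤q = subst (_≤ℚ q - p) (+-inverseʳ p) (+-monoˡ-≤ (- p) p≤q)

-- Turns an inequality into an explicit nonnegative gap `e` and a ring identity for the solver. Most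
-- estimates below have this form.
≤-by-gap : ∀ {p q e} → 0ℚ ≤ℚ e → q ≡ p + e → p ≤ℚ q
≤-by-gap {p} {q} {e} 0≤e q≡p+e = subst₂ _≤ℚ_ (+-identityʳ p) (sym q≡p+e) (+-monoʳ-≤ p 0≤e)

0≤1 : 0ℚ ≤ℚ 1ℚ
0≤1 = 0≤ι 1

0≤½ : 0ℚ ≤ℚ ½
0≤½ = nonNegative⁻¹ ½

*-cancelˡ : ∀ {a p q} → 0ℚ < a → a * p ≤ℚ a * q → p ≤ℚ q
*-cancelˡ {a} 0<a = *-cancelˡ-≤-pos a {{positive 0<a}}

*-monoˡ : ∀ {a p q} → 0ℚ ≤ℚ a → p ≤ℚ q → a * p ≤ℚ a * q
*-monoˡ {a} 0≤a = *-monoˡ-≤-nonNeg a {{nonNegative 0≤a}}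

*-monoʳ : ∀ {a p q} → 0ℚ ≤ℚ a → p ≤ℚ q → p * a ≤ℚ q * a
*-monoʳ {a} 0≤a = *-monoʳ-≤-nonNeg a {{nonNegative 0≤a}}

sq-mono-≤ : ∀ {p q} → 0ℚ ≤ℚ p → p ≤ℚ q → p * p ≤ℚ q * q
sq-mono-≤ {p} {q} 0≤p p≤q = ≤-by-gap (0≤-* (p≤q⇒0≤q-p p≤q) (0≤-+ (≤-trans 0≤p p≤q) 0≤p)) (solve (p ∷ q ∷ []) ℚ-ring)

sq-cancel-≤ : ∀ {p q} → 0ℚ ≤ℚ q → p * p ≤ℚ q * q → p ≤ℚ q
sq-cancel-≤ {p} {q} 0≤q pp≤qq = ≮⇒≥ λ q<p → <-irrefl refl (<-≤-trans (sq-< q<p) pp≤qq)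
  where
  sq-< : q < p → q * q < p * p
  sq-< q<p = ≤-<-trans (*-monoˡ 0≤q (<⇒≤ q<p)) (*-monoˡ-<-pos p {{positive (≤-<-trans 0≤q q<p)}} q<p)

-- One backward step: bounds on the drop of u.

module _ {σ v : ℚ} (0≤σ : 0ℚ ≤ℚ σ) (σ≤v : σ ≤ℚ v) where
  cubic-≤ : (σ * σ) * (v + v - (σ + 1ℚ)) ≤ℚ v * v * v
  cubic-≤ = ≤-by-gap
    (0≤-+ (0≤-* 0≤σ 0≤σ) (0≤-+ (0≤-* 0≤v-σ (0≤-* 0≤v 0≤v)) (0≤-* 0≤σ (0≤-* 0≤v-σ 0≤v-σ))))
    (solve (σ ∷ v ∷ []) ℚ-ring)
    where
    0≤v : 0ℚ ≤ℚ v
    0≤v = ≤-trans 0≤σ σ≤v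
    0≤v-σ : 0ℚ ≤ℚ v - σ
    0≤v-σ = p≤q⇒0≤q-p σ≤v

  -- With d = v - σ in [0, 1] the gap is v²(1 - d) + σd(2 - d) + d².
  cubic-≥ : v ≤ℚ σ + 1ℚ → v * v * v - ι 2 * (v * v) ≤ℚ (σ * σ) * (v + v - (σ + 1ℚ))
  cubic-≥ v≤σ+1 = ≤-by-gap
    (0≤-+ (0≤-* (0≤-* 0≤v 0≤v) 0≤gap) (0≤-+ (0≤-* (0≤-* 0≤σ 0≤v-σ) (0≤-+ 0≤gap 0≤1)) (0≤-* 0≤v-σ 0≤v-σ)))
    (solve (σ ∷ v ∷ []) ℚ-ring)
    where
    0≤v : 0ℚ ≤ℚ v
    0≤v = ≤-trans 0≤σ σ≤v
    0≤v-σ : 0ℚ ≤ℚ v - σ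
    0≤v-σ = p≤q⇒0≤q-p σ≤v
    0≤gap : 0ℚ ≤ℚ σ + 1ℚ - v
    0≤gap = p≤q⇒0≤q-p v≤σ+1

-- Integrality of `s` matters here: for s = 0 the second factor may be negative but the product
-- vanishes, and for s ≥ 1 that factor is (v - s) + (v - 1).
0≤cubic : ∀ s {v} → ℤ.0ℤ ℤ.≤ s → s / 1 ≤ℚ v → 0ℚ ≤ℚ ((s / 1) * (s / 1)) * (v + v - (s / 1 + 1ℚ))
0≤cubic (+ zero) {v} _ _ = ≤-reflexive (sym (*-zeroˡ (v + v - (0ℚ + 1ℚ))))
0≤cubic (+ suc m) {v} _ σ≤v = 0≤-* (0≤-* (0≤ι (suc m)) (0≤ι (suc m))) (≤-trans (+-mono-≤ (p≤q⇒0≤q-p σ≤v) (p≤q⇒0≤q-p (≤-trans (1≤ι-suc m) σ≤v))) (≤-reflexive (rearrange (ι (suc m)))))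
  where
  rearrange : ∀ σ → (v - σ) + (v - 1ℚ) ≡ v + v - (σ + 1ℚ)
  rearrange σ = solve (σ ∷ v ∷ []) ℚ-ring

-- n = r + 1, u = u_{r+1}, u' = u_r, v = n u.
record Descent (n r u u' : ℚ) : Set where
  field
    drop≥0  : 0ℚ ≤ℚ (n * (r * r)) * (ι 2 * (u - u'))
    drop≤v³ : (n * (r * r)) * (ι 2 * (u - u')) ≤ℚ (n * u) * (n * u) * (n * u)
    drop≥v³ : (n * u) * (n * u) * (n * u) - ι 2 * ((n * u) * (n * u)) ≤ℚ (n * (r * r)) * (ι 2 * (u - u'))

module _ {n r u u' : ℚ} (0<n : 0ℚ < n) (0<r : 0ℚ < r) (0≤u : 0ℚ ≤ℚ u) (descent : Descent n r u u') where
  open Descent descent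

  private
    0≤n : 0ℚ ≤ℚ n
    0≤n = <⇒≤ 0<n
    0≤r : 0ℚ ≤ℚ r
    0≤r = <⇒≤ 0<r
    0≤u³ : 0ℚ ≤ℚ u * u * u
    0≤u³ = 0≤-* (0≤-* 0≤u 0≤u) 0≤u
    0<nrr : 0ℚ < n * (r * r)
    0<nrr = positive⁻¹ (n * (r * r)) {{pos*pos⇒pos n {{positive 0<n}} (r * r) {{pos*pos⇒pos r {{positive 0<r}} r {{positive 0<r}}}}}}

  decreasing : u' ≤ℚ u
  decreasing = ≤-by-gap (0≤-* 0≤½ (*-cancelˡ 0<nrr (≤-trans (≤-reflexive (*-zeroʳ (n * (r * r)))) drop≥0))) (solve (u ∷ u' ∷ []) ℚ-ring)

  -- Dividing n³u³ by nr² leaves (n/r)²u³, so `c` has to dominate (n/r)². It is used with c = 4 for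
  -- all r, and with c = 1 + 3κ for r ≥ K.
  drop-≤ : ∀ {c} → n * n ≤ℚ c * (r * r) → ι 2 * (u - u') ≤ℚ c * (u * u * u)
  drop-≤ {c} nn≤crr = *-cancelˡ 0<nrr (≤-by-gap
    (0≤-+ (p≤q⇒0≤q-p drop≤v³) (0≤-* (0≤-* 0≤n 0≤u³) (p≤q⇒0≤q-p nn≤crr)))
    (solve (n ∷ r ∷ u ∷ u' ∷ c ∷ []) ℚ-ring))

  -- Since κv ≥ 1, the error 2v² is at most 2κv³; then r ≤ n replaces n³u³ by nr²u³.
  drop-≥ : ∀ {κ} → 0ℚ ≤ℚ 1ℚ - ι 2 * κ → r ≤ℚ n → 1ℚ ≤ℚ κ * (n * u) →
           (1ℚ - ι 2 * κ) * (u * u * u) ≤ℚ ι 2 * (u - u')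
  drop-≥ {κ} 0≤λ r≤n 1≤κv = *-cancelˡ 0<nrr (≤-by-gap
    (0≤-+ (p≤q⇒0≤q-p drop≥v³) (0≤-+
      (0≤-* (0≤-* (0≤ι 2) (0≤-* 0≤v 0≤v)) (p≤q⇒0≤q-p 1≤κv))
      (0≤-* (0≤-* 0≤n (0≤-* 0≤λ 0≤u³)) (p≤q⇒0≤q-p (sq-mono-≤ 0≤r r≤n)))))
    (solve (n ∷ r ∷ u ∷ u' ∷ κ ∷ []) ℚ-ring))
    where
    0≤v : 0ℚ ≤ℚ n * u
    0≤v = 0≤-* 0≤n 0≤u

-- Effect of one step on 1/u².

module _ {u u' : ℚ} (0≤u : 0ℚ ≤ℚ u) (4uu≤1 : ι 4 * (u * u) ≤ℚ 1ℚ) where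

  private
    0≤uu : 0ℚ ≤ℚ u * u
    0≤uu = 0≤-* 0≤u 0≤u
    0≤1-4uu : 0ℚ ≤ℚ 1ℚ - ι 4 * (u * u)
    0≤1-4uu = p≤q⇒0≤q-p 4uu≤1

  -- The drop is at most half of u, because 4u³ ≤ u when 4u² ≤ 1.
  halving : ι 2 * (u - u') ≤ℚ ι 4 * (u * u * u) → u ≤ℚ ι 2 * u'
  halving drop≤ = ≤-by-gap (0≤-+ (p≤q⇒0≤q-p drop≤) (0≤-* 0≤u 0≤1-4uu)) (solve (u ∷ u' ∷ []) ℚ-ring)

  -- With x = λu²/2 the step multiplies u by at most 1 − x, and (1 − x)²(1 + 2x) ≤ 1.
  inverse-square-≥ : ∀ {l W} → 0ℚ ≤ℚ u' → 0ℚ ≤ℚ l → l ≤ℚ 1ℚ → 0ℚ ≤ℚ W →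
    (u * u) * W ≤ℚ 1ℚ → l * (u * u * u) ≤ℚ ι 2 * (u - u') → (u' * u') * (W + l) ≤ℚ 1ℚ
  inverse-square-≥ {l} {W} 0≤u' 0≤l l≤1 0≤W uuW≤1 drop≥ = ≤-trans {j = ((u * (1ℚ - ½ * (l * (u * u)))) * (u * (1ℚ - ½ * (l * (u * u))))) * (W + l)}
    (*-monoʳ {W + l} (0≤-+ 0≤W 0≤l) (sq-mono-≤ 0≤u' u'≤p))
    -- As u²l = 2x and u²W ≤ 1, the left side is at most (1 - x)²(1 + 2x) = 1 - x²(3 - 2x).
    (≤-by-gap (0≤-+ (0≤-* 0≤sq (p≤q⇒0≤q-p uuW≤1)) (0≤-* (0≤-* 0≤x 0≤x) 0≤3-2x))
      (solve (u ∷ l ∷ W ∷ []) ℚ-ring))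
    where
    u'≤p : u' ≤ℚ u * (1ℚ - ½ * (l * (u * u)))
    u'≤p = ≤-by-gap (0≤-* 0≤½ (p≤q⇒0≤q-p drop≥)) (solve (u ∷ u' ∷ l ∷ []) ℚ-ring)
    0≤x : 0ℚ ≤ℚ ½ * (l * (u * u))
    0≤x = 0≤-* 0≤½ (0≤-* 0≤l 0≤uu)
    0≤1-x : 0ℚ ≤ℚ 1ℚ - ½ * (l * (u * u))
    0≤1-x = ≤-trans (0≤-* 0≤½ (0≤-+ (0≤-+ 0≤1 0≤1-4uu) (0≤-+ (0≤-* (0≤ι 3) 0≤uu) (0≤-* (p≤q⇒0≤q-p l≤1) 0≤uu))))
      (≤-reflexive (solve (u ∷ l ∷ []) ℚ-ring))
    0≤3-2x : 0ℚ ≤ℚ ι 3 - ι 2 * (½ * (l * (u * u)))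
    0≤3-2x = ≤-trans (0≤-+ 0≤1 (0≤-* (0≤ι 2) 0≤1-x)) (≤-reflexive (solve (u ∷ l ∷ []) ℚ-ring))
    0≤sq : 0ℚ ≤ℚ (1ℚ - ½ * (l * (u * u))) * (1ℚ - ½ * (l * (u * u)))
    0≤sq = 0≤-* 0≤1-x 0≤1-x

  -- With x = cu²/2 the step multiplies u by at least 1 − x, and (1 − x)² ≥ 1 − 2x.
  inverse-square-≤ : ∀ {c L κ B} → 0ℚ ≤ℚ c → c ≤ℚ ι 4 → 0ℚ ≤ℚ L → 0ℚ ≤ℚ B →
    c + c * L * κ ≤ℚ L → u * u ≤ℚ κ → 1ℚ ≤ℚ (u * u) * B →
    ι 2 * (u - u') ≤ℚ c * (u * u * u) → 1ℚ ≤ℚ (u' * u') * (B + L)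
  inverse-square-≤ {c} {L} {κ} {B} 0≤c c≤4 0≤L 0≤B c≤L uu≤κ 1≤uuB drop≤ = ≤-trans {j = ((u * (1ℚ - ½ * (c * (u * u)))) * (u * (1ℚ - ½ * (c * (u * u))))) * (B + L)}
    (≤-by-gap (0≤-+ (0≤-* 0≤1-cuu (p≤q⇒0≤q-p 1≤uuB)) (0≤-+
        -- The gain u²L must pay for cu² and for the cross term cLu⁴; u² ≤ κ reduces this to
        -- `c + c * L * κ ≤ L`.
        (0≤-* 0≤uu (0≤-+ (p≤q⇒0≤q-p c≤L) (0≤-* (0≤-* 0≤c 0≤L) (p≤q⇒0≤q-p uu≤κ))))
        (0≤-* (0≤-* 0≤uu (0≤-* 0≤x 0≤x)) 0≤B+L)))
      (solve (u ∷ c ∷ L ∷ κ ∷ B ∷ []) ℚ-ring))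
    (*-monoʳ {B + L} 0≤B+L (sq-mono-≤ 0≤p p≤u'))
    where
    0≤B+L : 0ℚ ≤ℚ B + L
    0≤B+L = 0≤-+ 0≤B 0≤L
    0≤1-cuu : 0ℚ ≤ℚ 1ℚ - c * (u * u)
    0≤1-cuu = ≤-trans (0≤-+ 0≤1-4uu (0≤-* (p≤q⇒0≤q-p c≤4) 0≤uu)) (≤-reflexive (solve (u ∷ c ∷ []) ℚ-ring))
    0≤x : 0ℚ ≤ℚ ½ * (c * (u * u))
    0≤x = 0≤-* 0≤½ (0≤-* 0≤c 0≤uu)
    0≤p : 0ℚ ≤ℚ u * (1ℚ - ½ * (c * (u * u)))
    0≤p = 0≤-* 0≤u (≤-trans (0≤-+ 0≤1-cuu 0≤x) (≤-reflexive (solve (u ∷ c ∷ []) ℚ-ring)))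
    p≤u' : u * (1ℚ - ½ * (c * (u * u))) ≤ℚ u'
    p≤u' = ≤-by-gap (0≤-* 0≤½ (p≤q⇒0≤q-p drop≤)) (solve (u ∷ u' ∷ c ∷ []) ℚ-ring)

  -- Losing at most half of u multiplies 1/u² by at most 4, and κ ≤ u² means 1/u² ≤ K.
  inverse-square-large : ∀ {κ K B} → 0ℚ ≤ℚ K → κ * K ≡ 1ℚ → κ ≤ℚ u * u → u ≤ℚ ι 2 * u' → ι 4 * K ≤ℚ B → 1ℚ ≤ℚ (u' * u') * B
  inverse-square-large {κ} {K} {B} 0≤K κK≡1 κ≤uu u≤2u' 4K≤B = subst (_≤ℚ (u' * u') * B) κK≡1 (≤-by-gap
    (0≤-+ (0≤-* 0≤K (p≤q⇒0≤q-p κ≤uu)) (0≤-+ (0≤-* 0≤K (p≤q⇒0≤q-p (sq-mono-≤ 0≤u u≤2u'))) (0≤-* 0≤u'u' (p≤q⇒0≤q-p 4K≤B))))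
    (solve (u ∷ u' ∷ κ ∷ K ∷ B ∷ []) ℚ-ring))
    where
    0≤u' : 0ℚ ≤ℚ u'
    0≤u' = *-cancelˡ {ι 2} (0<ι-suc 1) (≤-trans 0≤u u≤2u')
    0≤u'u' : 0ℚ ≤ℚ u' * u'
    0≤u'u' = 0≤-* 0≤u' 0≤u'

-- The recursion in terms of u = R/(N+1).

recip : ℕ → ℚ
recip m = + 1 / suc m

recip-inverse : ∀ m → recip m * ι (suc m) ≡ 1ℚ
recip-inverse m = /-cancel (+ 1) m

/≡*recip : ∀ i m → i / suc m ≡ (i / 1) * recip m
/≡*recip i m = trans (expand (i / suc m) (recip m) (ι (suc m)) (recip-inverse m)) (cong (_* recip m) (/-cancel i m))
  where
  expand : ∀ p c d → c * d ≡ 1ℚ → p ≡ p * d * c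
  expand p c d cd≡1 = trans (sym (*-identityʳ p)) (trans (cong (p *_) (sym cd≡1)) (solve (p ∷ c ∷ d ∷ []) ℚ-ring))

-- The drop is iq²(x - ab). The fractions enter only through their products with their denominators,
-- so that the regrouping is a polynomial identity.
drop-identity : ∀ {n r i x q a b M σ} → q * r ≡ σ → a * n ≡ M → b * ι 2 ≡ σ + 1ℚ → i * M ≡ 1ℚ →
  (n * (r * r)) * (ι 2 * (i * x - i * (((q * q) * a) * b + (1ℚ - q * q) * x)))
    ≡ (σ * σ) * ((n * (i * x)) + (n * (i * x)) - (σ + 1ℚ))
drop-identity {n} {r} {i} {x} {q} {a} {b} {M} {σ} qr≡σ an≡M 2b≡σ+1 iM≡1 =
  trans regroup (cong₂ _*_ (cong₂ _*_ qr≡σ qr≡σ) (cong (λ t → (n * (i * x)) + (n * (i * x)) - t) last))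
  where
  regroup : (n * (r * r)) * (ι 2 * (i * x - i * (((q * q) * a) * b + (1ℚ - q * q) * x)))
    ≡ ((q * r) * (q * r)) * ((n * (i * x)) + (n * (i * x)) - (i * (a * n)) * (b * ι 2))
  regroup = solve (n ∷ r ∷ i ∷ x ∷ q ∷ a ∷ b ∷ []) ℚ-ring
  last : (i * (a * n)) * (b * ι 2) ≡ σ + 1ℚ
  last = trans (cong₂ _*_ (trans (cong (i *_) an≡M) iM≡1) 2b≡σ+1) (*-identityˡ (σ + 1ℚ))

-- scaled N k is u_{N−k}.
scaled : ℕ → ℕ → ℚ
scaled N k = recip N * Rfrom N k

step-descent : ∀ N r x → 0ℚ ≤ℚ recip N * x →
  Descent (ι (suc (suc r))) (ι (suc r)) (recip N * x) (recip N * step N (suc r) x)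
step-descent N r x 0≤ix = record
  { drop≥0  = subst (0ℚ ≤ℚ_) (sym identity) (0≤cubic s 0≤s σ≤v)
  ; drop≤v³ = subst (_≤ℚ v * v * v) (sym identity) (cubic-≤ 0≤σ σ≤v)
  ; drop≥v³ = subst (v * v * v - ι 2 * (v * v) ≤ℚ_) (sym identity) (cubic-≥ 0≤σ σ≤v v≤σ+1)
  }
  where
  s : ℤ
  s = threshold N (suc r) x
  v : ℚ
  v = ι (suc (suc r)) * (recip N * x)
  v≡ : (+ suc (suc r) / suc N) * x ≡ v
  v≡ = trans (cong (_* x) (/≡*recip (+ suc (suc r)) N)) (*-assoc (ι (suc (suc r))) (recip N) x)
  0≤v : 0ℚ ≤ℚ v
  0≤v = 0≤-* (0≤ι (suc (suc r))) 0≤ix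
  0≤s : ℤ.0ℤ ℤ.≤ s
  0≤s = 0≤floor ((+ suc (suc r) / suc N) * x) (subst (0ℚ ≤ℚ_) (sym v≡) 0≤v)
  0≤σ : 0ℚ ≤ℚ s / 1
  0≤σ = /1-mono-≤ 0≤s
  σ≤v : s / 1 ≤ℚ v
  σ≤v = subst (s / 1 ≤ℚ_) v≡ (floor≤ ((+ suc (suc r) / suc N) * x))
  v≤σ+1 : v ≤ℚ s / 1 + 1ℚ
  v≤σ+1 = subst (_≤ℚ s / 1 + 1ℚ) v≡ (≤floor+1 ((+ suc (suc r) / suc N) * x))
  identity : (ι (suc (suc r)) * (ι (suc r) * ι (suc r))) * (ι 2 * (recip N * x - recip N * step N (suc r) x))
    ≡ ((s / 1) * (s / 1)) * (v + v - (s / 1 + 1ℚ))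
  identity = drop-identity {n = ι (suc (suc r))} {r = ι (suc r)} {i = recip N} {x = x} {q = s / suc r} {a = + suc N / suc (suc r)} {b = (s ℤ.+ ℤ.1ℤ) / 2} {M = ι (suc N)} {σ = s / 1}
    (/-cancel s r) (/-cancel (+ suc N) (suc r))
    (trans (/-cancel (s ℤ.+ ℤ.1ℤ) 1) (sym (/1-homo-+ s ℤ.1ℤ))) (recip-inverse N)

-- The round is written `suc r`, which excludes round 0, where `step` is the identity; the equation
-- on `k` and `r` resolves the truncated subtraction in `Rfrom`.
scaled-descent : ∀ N k r → suc k ℕ.+ suc r ≡ N → 0ℚ ≤ℚ scaled N k →
  Descent (ι (suc (suc r))) (ι (suc r)) (scaled N k) (scaled N (suc k))
scaled-descent N k r k+r≡N 0≤u = subst (λ j → Descent (ι (suc (suc r))) (ι (suc r)) (scaled N k) (recip N * step N j (Rfrom N k)))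
  (sym (trans (cong (_∸ suc k) (sym k+r≡N)) (ℕ.m+n∸m≡n (suc k) (suc r))))
  (step-descent N r (Rfrom N k) 0≤u)

ratio≤4 : ∀ r → ι (suc (suc r)) * ι (suc (suc r)) ≤ℚ ι 4 * (ι (suc r) * ι (suc r))
ratio≤4 r = subst (λ n → n * n ≤ℚ ι 4 * (ι (suc r) * ι (suc r))) (sym (ι-suc (suc r))) (lemma (ι (suc r)) (1≤ι-suc r))
  where
  lemma : ∀ t → 1ℚ ≤ℚ t → (t + 1ℚ) * (t + 1ℚ) ≤ℚ ι 4 * (t * t)
  lemma t 1≤t = ≤-by-gap (0≤-* (p≤q⇒0≤q-p 1≤t) (0≤-+ (0≤-* (0≤ι 3) (≤-trans 0≤1 1≤t)) 0≤1)) (solve (t ∷ []) ℚ-ring)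

scaled-zero : ∀ N → scaled N 0 ≡ ½
scaled-zero N = trans (cong (recip N *_) (/≡*recip (+ suc N) 1))
  (trans (sym (*-assoc (recip N) (ι (suc N)) ½)) (trans (cong (_* ½) (recip-inverse N)) (*-identityˡ ½)))

+-suc-shift : ∀ {N} k r → suc k ℕ.+ suc r ≡ N → k ℕ.+ suc (suc r) ≡ N
+-suc-shift k r = trans (ℕ.+-suc k (suc r))

-- Bounds on u valid in every round.

module _ (N : ℕ) where

  private
    u : ℕ → ℚ
    u = scaled N

  -- Proved by a joint induction with the next three: 4u² ≤ 1, an equality at the start u = ½,
  -- bounds the drop by 4u³; this gives halving and hence u' ≥ 0, and monotonicity preserves 4u² ≤
  -- 1.
  scaled-bounds : ∀ k r → k ℕ.+ suc r ≡ N → 0ℚ ≤ℚ u k × ι 4 * (u k * u k) ≤ℚ 1ℚ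
  scaled-drop≤4 : ∀ k r → suc k ℕ.+ suc r ≡ N → ι 2 * (u k - u (suc k)) ≤ℚ ι 4 * (u k * u k * u k)
  scaled-antitone : ∀ k r → suc k ℕ.+ suc r ≡ N → u (suc k) ≤ℚ u k
  scaled-halving : ∀ k r → suc k ℕ.+ suc r ≡ N → u k ≤ℚ ι 2 * u (suc k)

  scaled-bounds zero r _ = subst (λ t → 0ℚ ≤ℚ t × ι 4 * (t * t) ≤ℚ 1ℚ) (sym (scaled-zero N)) (0≤½ , ≤-refl)
  scaled-bounds (suc k) r eq =
    let (0≤u , 4uu≤1) = scaled-bounds k (suc r) (+-suc-shift k r eq)
        0≤u' = *-cancelˡ {ι 2} {0ℚ} (0<ι-suc 1) (≤-trans 0≤u (scaled-halving k r eq))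
    in 0≤u' , ≤-trans (*-monoˡ {ι 4} (0≤ι 4) (sq-mono-≤ 0≤u' (scaled-antitone k r eq))) 4uu≤1

  scaled-drop≤4 k r eq = drop-≤ (0<ι-suc (suc r)) (0<ι-suc r) 0≤u (scaled-descent N k r eq 0≤u) {ι 4} (ratio≤4 r)
    where
    0≤u : 0ℚ ≤ℚ u k
    0≤u = proj₁ (scaled-bounds k (suc r) (+-suc-shift k r eq))

  scaled-antitone k r eq = decreasing (0<ι-suc (suc r)) (0<ι-suc r) 0≤u (scaled-descent N k r eq 0≤u)
    where
    0≤u : 0ℚ ≤ℚ u k
    0≤u = proj₁ (scaled-bounds k (suc r) (+-suc-shift k r eq))

  scaled-halving k r eq =
    let (0≤u , 4uu≤1) = scaled-bounds k (suc r) (+-suc-shift k r eq)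
    in halving {u k} {u (suc k)} 0≤u 4uu≤1 (scaled-drop≤4 k r eq)

  -- Upper bound on 1/u², with error parameter κ = 1/K.

  module _ (K : ℕ) (κ : ℚ) (κK≡1 : κ * ι K ≡ 1ℚ) (0≤κ : 0ℚ ≤ℚ κ) (12κ≤1 : ι 12 * κ ≤ℚ 1ℚ) where

    private
      0≤1-12κ : 0ℚ ≤ℚ 1ℚ - ι 12 * κ
      0≤1-12κ = p≤q⇒0≤q-p 12κ≤1

      lo : ℚ
      lo = 1ℚ - ι 2 * κ

      0≤lo : 0ℚ ≤ℚ 1ℚ - ι 2 * κ
      0≤lo = ≤-trans (0≤-+ 0≤1-12κ (0≤-* (0≤ι 10) 0≤κ)) (≤-reflexive (solve (κ ∷ []) ℚ-ring))

      0≤1-κ : 0ℚ ≤ℚ 1ℚ - κ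
      0≤1-κ = ≤-trans (0≤-+ 0≤1-12κ (0≤-* (0≤ι 11) 0≤κ)) (≤-reflexive (solve (κ ∷ []) ℚ-ring))

      lo≤1 : 1ℚ - ι 2 * κ ≤ℚ 1ℚ
      lo≤1 = ≤-by-gap (0≤-* (0≤ι 2) 0≤κ) (solve (κ ∷ []) ℚ-ring)

      hi : ℚ
      hi = 1ℚ + ι 8 * κ

      0≤hi : 0ℚ ≤ℚ 1ℚ + ι 8 * κ
      0≤hi = 0≤-+ 0≤1 (0≤-* (0≤ι 8) 0≤κ)

      κ·ι≥1 : ∀ {n} → K ≤ n → 1ℚ ≤ℚ κ * ι n
      κ·ι≥1 {n} K≤n = subst (_≤ℚ κ * ι n) κK≡1 (*-monoˡ {κ} 0≤κ (ι-mono-≤ K n K≤n))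

    -- At round r + 1 = N − k: 4K accounts for the steps from 1/u² ≤ K, and K ∸ (r + 1) is the
    -- number of steps already made to rounds below K.
    bound : ℕ → ℕ → ℚ
    bound k r = ι 4 * ι K + (hi * ι k + ι 8 * ι (K ∸ suc r))

    0≤bound-tail : ∀ k r → 0ℚ ≤ℚ hi * ι k + ι 8 * ι (K ∸ suc r)
    0≤bound-tail k r = 0≤-+ (0≤-* 0≤hi (0≤ι k)) (0≤-* (0≤ι 8) (0≤ι (K ∸ suc r)))

    0≤bound : ∀ k r → 0ℚ ≤ℚ bound k r
    0≤bound k r = 0≤-+ (0≤-* (0≤ι 4) (0≤ι K)) (0≤bound-tail k r)

    4K≤bound : ∀ k r → ι 4 * ι K ≤ℚ bound k r
    4K≤bound k r = ≤-by-gap (0≤bound-tail k r) refl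

    bound-step-far : ∀ k r → K ≤ suc r → bound (suc k) r ≡ bound k (suc r) + hi
    bound-step-far k r K≤r =
      trans (cong₂ (λ a b → ι 4 * ι K + (hi * a + ι 8 * b)) (ι-suc k) (cong ι (ℕ.m≤n⇒m∸n≡0 K≤r)))
        (trans (lemma (ι K) (ι k)) (cong (λ b → ι 4 * ι K + (hi * ι k + ι 8 * b) + hi) (cong ι (sym (ℕ.m≤n⇒m∸n≡0 (ℕ.m≤n⇒m≤1+n K≤r))))))
      where
      lemma : ∀ a b → ι 4 * a + ((1ℚ + ι 8 * κ) * (b + 1ℚ) + ι 8 * ι 0) ≡ ι 4 * a + ((1ℚ + ι 8 * κ) * b + ι 8 * ι 0) + (1ℚ + ι 8 * κ)
      lemma a b = solve (a ∷ b ∷ κ ∷ []) ℚ-ring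

    bound-step-near : ∀ k r → suc r ℕ.< K → bound k (suc r) + ι 8 ≤ℚ bound (suc k) r
    bound-step-near k r r<K = subst₂ (λ a b → bound k (suc r) + ι 8 ≤ℚ ι 4 * ι K + (hi * a + ι 8 * b)) (sym (ι-suc k)) (sym gap)
        (lemma (ι K) (ι k) (ι (K ∸ suc (suc r))))
      where
      gap : ι (K ∸ suc r) ≡ ι (K ∸ suc (suc r)) + 1ℚ
      gap = trans (cong ι (ℕ.+-∸-assoc 1 r<K)) (ι-suc (K ∸ suc (suc r)))
      lemma : ∀ a b t → ι 4 * a + ((1ℚ + ι 8 * κ) * b + ι 8 * t) + ι 8 ≤ℚ ι 4 * a + ((1ℚ + ι 8 * κ) * (b + 1ℚ) + ι 8 * (t + 1ℚ))
      lemma a b t = ≤-by-gap 0≤hi (solve (a ∷ b ∷ t ∷ κ ∷ []) ℚ-ring)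

    -- If κ ≤ u², the summand 4K of `bound` suffices. Otherwise the induction hypothesis is extended
    -- by 8 or by `hi`, according to whether the new round lies below K.
    1≤uu*bound : ∀ k r → k ℕ.+ suc r ≡ N → 1ℚ ≤ℚ (u k * u k) * bound k r
    1≤uu*bound zero r _ = subst (λ t → 1ℚ ≤ℚ (t * t) * bound 0 r) (sym (scaled-zero N))
      -- At the start u² = 1/4, so the summand 4K alone contributes K ≥ 1.
      (≤-trans 1≤K (lemma (ι K) (0≤bound-tail 0 r)))
      where
      κ*≤ : ∀ t → 0ℚ ≤ℚ t → κ * t ≤ℚ t
      κ*≤ t 0≤t = ≤-by-gap (0≤-* 0≤1-κ 0≤t) (solve (κ ∷ t ∷ []) ℚ-ring)
      1≤K : 1ℚ ≤ℚ ι K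
      1≤K = subst (_≤ℚ ι K) κK≡1 (κ*≤ (ι K) (0≤ι K))
      lemma : ∀ a {b} → 0ℚ ≤ℚ b → a ≤ℚ (½ * ½) * (ι 4 * a + b)
      lemma a {b} 0≤b = ≤-by-gap (0≤-* (0≤-* 0≤½ 0≤½) 0≤b) (solve (a ∷ b ∷ []) ℚ-ring)
    1≤uu*bound (suc k) r eq with ≤-total κ (u k * u k) | suc r ℕ.<? K
    ... | inj₁ κ≤uu | _ = inverse-square-large {u k} {u (suc k)} 0≤u 4uu≤1 (0≤ι K) κK≡1 κ≤uu (scaled-halving k r eq) (4K≤bound (suc k) r)
      where
      eq' = +-suc-shift k r eq
      0≤u = proj₁ (scaled-bounds k (suc r) eq')
      4uu≤1 = proj₂ (scaled-bounds k (suc r) eq')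
    ... | inj₂ uu≤κ | yes r<K = ≤-trans
        -- The pair c = 4, L = 8 is admissible: 4 + 32κ ≤ 8 by 12κ ≤ 1.
        (inverse-square-≤ {u k} {u (suc k)} 0≤u 4uu≤1 {ι 4} {ι 8} {κ} (0≤ι 4) ≤-refl (0≤ι 8) (0≤bound k (suc r))
          (≤-by-gap (0≤-* (0≤ι 4) (0≤-+ 0≤1-12κ (0≤-* (0≤ι 4) 0≤κ))) (solve (κ ∷ []) ℚ-ring))
          uu≤κ (1≤uu*bound k (suc r) eq') (scaled-drop≤4 k r eq))
        (*-monoˡ {u (suc k) * u (suc k)} (0≤-* 0≤u' 0≤u') (bound-step-near k r r<K))
      where
      eq' = +-suc-shift k r eq
      0≤u = proj₁ (scaled-bounds k (suc r) eq')
      4uu≤1 = proj₂ (scaled-bounds k (suc r) eq')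
      0≤u' = proj₁ (scaled-bounds (suc k) r eq)
    ... | inj₂ uu≤κ | no r≮K = subst (λ B → 1ℚ ≤ℚ (u (suc k) * u (suc k)) * B) (sym (bound-step-far k r K≤r))
        (inverse-square-≤ {u k} {u (suc k)} 0≤u 4uu≤1 {1ℚ + ι 3 * κ} {hi} {κ} (0≤-+ 0≤1 (0≤-* (0≤ι 3) 0≤κ))
          (≤-by-gap (0≤-+ (0≤-* (0≤ι 3) 0≤1-12κ) (0≤-* (0≤ι 33) 0≤κ)) (solve (κ ∷ []) ℚ-ring)) 0≤hi (0≤bound k (suc r))
          c≤L uu≤κ (1≤uu*bound k (suc r) eq')
          (drop-≤ (0<ι-suc (suc r)) (0<ι-suc r) 0≤u (scaled-descent N k r eq 0≤u) {1ℚ + ι 3 * κ} ratio))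
      where
      eq' = +-suc-shift k r eq
      0≤u = proj₁ (scaled-bounds k (suc r) eq')
      4uu≤1 = proj₂ (scaled-bounds k (suc r) eq')
      K≤r : K ≤ suc r
      K≤r = ℕ.≮⇒≥ r≮K
      -- The left side is 1 + 4κ + 11κ² + 24κ³, and 11κ + 24κ² ≤ 4 for κ ≤ 1/12.
      c≤L : (1ℚ + ι 3 * κ) + (1ℚ + ι 3 * κ) * (1ℚ + ι 8 * κ) * κ ≤ℚ 1ℚ + ι 8 * κ
      c≤L = ≤-by-gap (0≤-* 0≤κ (0≤-+ (0≤-+ (0≤-* (0≤-* (0≤ι 2) 0≤κ) 0≤1-12κ) (0≤-* (0≤ι 2) 0≤1-12κ)) (0≤-+ (0≤ι 2) (0≤-* (0≤ι 11) 0≤κ))))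
        (solve (κ ∷ []) ℚ-ring)
      -- (1 + 1/t)² ≤ 1 + 3/t for t ≥ 1, and 1/t ≤ κ.
      lemma : ∀ t → 1ℚ ≤ℚ t → 1ℚ ≤ℚ κ * t → (t + 1ℚ) * (t + 1ℚ) ≤ℚ (1ℚ + ι 3 * κ) * (t * t)
      lemma t 1≤t 1≤κt = ≤-by-gap (0≤-+ (0≤-* (0≤-* (0≤ι 3) (≤-trans 0≤1 1≤t)) (p≤q⇒0≤q-p 1≤κt)) (p≤q⇒0≤q-p 1≤t)) (solve (t ∷ κ ∷ []) ℚ-ring)
      ratio : ι (suc (suc r)) * ι (suc (suc r)) ≤ℚ (1ℚ + ι 3 * κ) * (ι (suc r) * ι (suc r))
      ratio = subst (λ n → n * n ≤ℚ (1ℚ + ι 3 * κ) * (ι (suc r) * ι (suc r))) (sym (ι-suc (suc r)))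
        (lemma (ι (suc r)) (1≤ι-suc r) (κ·ι≥1 K≤r))

    -- Lower bound on 1/u²: about (1 - κ)N steps contribute 1 - 2κ each.

    target : ℚ
    target = (1ℚ - ι 2 * κ) * (1ℚ - κ) * ι N

    -- When `j` steps are made and at most κt of the t rounds remain, j ≥ (1 - κ)t, so the linear
    -- bound has reached the target.
    target≤late : ∀ {j m t} → j + m ≡ t → m ≤ℚ κ * t → (1ℚ - ι 2 * κ) * (1ℚ - κ) * t ≤ℚ (1ℚ - ι 2 * κ) * j
    target≤late {j} {m} refl m≤κt = ≤-by-gap (0≤-* 0≤lo (p≤q⇒0≤q-p m≤κt)) (solve (κ ∷ j ∷ m ∷ []) ℚ-ring)

    -- Either 1/u² has reached `target`, which persists because u decreases, or every step so far
    -- has contributed `lo`. The hypothesis says N ≥ K⁴; it keeps v ≥ K while the target is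
    -- unreached and n ≥ κN.
    target-or-linear : 1ℚ ≤ℚ κ * (κ * (κ * (κ * ι N))) → ∀ k r → k ℕ.+ suc r ≡ N →
      (u k * u k) * target ≤ℚ 1ℚ ⊎ (u k * u k) * (lo * ι k) ≤ℚ 1ℚ
    target-or-linear _ zero r _ = inj₂ (≤-trans (≤-reflexive (trans (cong ((u 0 * u 0) *_) (*-zeroʳ lo)) (*-zeroʳ (u 0 * u 0)))) 0≤1)
    target-or-linear 1≤κ⁴N (suc k) r eq = go (target-or-linear 1≤κ⁴N k (suc r) eq')
      where
      eq' : k ℕ.+ suc (suc r) ≡ N
      eq' = +-suc-shift k r eq
      n : ℚ
      n = ι (suc (suc r))
      k+n≡N : ι k + n ≡ ι N
      k+n≡N = trans (sym (ι-homo-+ k (suc (suc r)))) (cong ι eq')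
      0≤u : 0ℚ ≤ℚ u k
      0≤u = proj₁ (scaled-bounds k (suc r) eq')
      0≤uu : 0ℚ ≤ℚ u k * u k
      0≤uu = 0≤-* 0≤u 0≤u
      0≤u' : 0ℚ ≤ℚ u (suc k)
      0≤u' = proj₁ (scaled-bounds (suc k) r eq)
      0≤target : 0ℚ ≤ℚ target
      0≤target = 0≤-* (0≤-* 0≤lo 0≤1-κ) (0≤ι N)
      done : (u k * u k) * target ≤ℚ 1ℚ → (u (suc k) * u (suc k)) * target ≤ℚ 1ℚ
      done = ≤-trans (*-monoʳ {target} 0≤target (sq-mono-≤ 0≤u' (scaled-antitone k r eq)))
      target≤N : ∀ t → 0ℚ ≤ℚ t → (1ℚ - ι 2 * κ) * (1ℚ - κ) * t ≤ℚ t
      target≤N t 0≤t = ≤-by-gap (0≤-* (0≤-+ (0≤-* 0≤κ (0≤-* (0≤ι 2) 0≤1-κ)) 0≤κ) 0≤t) (solve (κ ∷ t ∷ []) ℚ-ring)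
      -- Here u²N ≥ 1 because target ≤ N, so (κnu)² ≥ (κ²Nu)² = κ⁴N · u²N ≥ 1.
      1≤κv : κ * ι N ≤ℚ n → 1ℚ ≤ℚ (u k * u k) * target → 1ℚ ≤ℚ κ * (n * u k)
      1≤κv κN≤n 1≤uuT = sq-cancel-≤ (0≤-* 0≤κ (0≤-* (0≤ι (suc (suc r))) 0≤u))
        (≤-trans (lemma (u k) (ι N) 1≤κ⁴N (≤-trans 1≤uuT (*-monoˡ {u k * u k} 0≤uu (target≤N (ι N) (0≤ι N)))))
          (lemma₂ (u k) 0≤u (0≤-* 0≤κ (0≤ι N)) κN≤n))
        where
        lemma : ∀ w t → 1ℚ ≤ℚ κ * (κ * (κ * (κ * t))) → 1ℚ ≤ℚ (w * w) * t → 1ℚ * 1ℚ ≤ℚ (κ * (κ * t * w)) * (κ * (κ * t * w))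
        lemma w t 1≤κ⁴t 1≤wwt = ≤-by-gap (0≤-+ (0≤-* (p≤q⇒0≤q-p 1≤κ⁴t) (≤-trans 0≤1 1≤wwt)) (p≤q⇒0≤q-p 1≤wwt)) (solve (κ ∷ w ∷ t ∷ []) ℚ-ring)
        lemma₂ : ∀ w {a b} → 0ℚ ≤ℚ w → 0ℚ ≤ℚ a → a ≤ℚ b → (κ * (a * w)) * (κ * (a * w)) ≤ℚ (κ * (b * w)) * (κ * (b * w))
        lemma₂ w 0≤w 0≤a a≤b = sq-mono-≤ (0≤-* 0≤κ (0≤-* 0≤a 0≤w)) (*-monoˡ {κ} 0≤κ (*-monoʳ {w} 0≤w a≤b))
      go : (u k * u k) * target ≤ℚ 1ℚ ⊎ (u k * u k) * (lo * ι k) ≤ℚ 1ℚ →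
           (u (suc k) * u (suc k)) * target ≤ℚ 1ℚ ⊎ (u (suc k) * u (suc k)) * (lo * ι (suc k)) ≤ℚ 1ℚ
      go (inj₁ early) = inj₁ (done early)
      go (inj₂ uuW≤1) with ≤-total n (κ * ι N) | ≤-total ((u k * u k) * target) 1ℚ
      ... | _ | inj₁ early = inj₁ (done early)
      ... | inj₁ n≤κN | _ = inj₁ (done (≤-trans (*-monoˡ {u k * u k} 0≤uu (target≤late k+n≡N n≤κN)) uuW≤1))
      ... | inj₂ κN≤n | inj₂ 1≤uuT = inj₂ (subst (λ t → (u (suc k) * u (suc k)) * t ≤ℚ 1ℚ) (sym lo*suc)
          (inverse-square-≥ {u k} {u (suc k)} 0≤u (proj₂ (scaled-bounds k (suc r) eq')) 0≤u' 0≤lo lo≤1 (0≤-* 0≤lo (0≤ι k)) uuW≤1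
            (drop-≥ (0<ι-suc (suc r)) (0<ι-suc r) 0≤u (scaled-descent N k r eq 0≤u) {κ} 0≤lo
              (ι-mono-≤ (suc r) (suc (suc r)) (ℕ.n≤1+n (suc r))) (1≤κv κN≤n 1≤uuT))))
        where
        lo*suc : lo * ι (suc k) ≡ lo * ι k + lo
        lo*suc = trans (cong (lo *_) (ι-suc k)) (trans (*-distribˡ-+ lo (ι k) 1ℚ) (cong (λ t → lo * ι k + t) (*-identityʳ lo)))

    -- At round 1 the remaining count is 1 ≤ κN, so the linear alternative also yields the target.
    uu*target≤1 : ∀ k → k ℕ.+ 1 ≡ N → 1ℚ ≤ℚ κ * ι N → 1ℚ ≤ℚ κ * (κ * (κ * (κ * ι N))) → (u k * u k) * target ≤ℚ 1ℚ
    uu*target≤1 k eq 1≤κN 1≤κ⁴N with target-or-linear 1≤κ⁴N k 0 eq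
    ... | inj₁ done = done
    ... | inj₂ uuW≤1 = ≤-trans (*-monoˡ {u k * u k} (0≤-* 0≤u 0≤u) (target≤late (trans (sym (ι-homo-+ k 1)) (cong ι eq)) 1≤κN)) uuW≤1
      where
      0≤u : 0ℚ ≤ℚ u k
      0≤u = proj₁ (scaled-bounds k 0 eq)

    -- The terms 4K and 8(K ∸ 1) total at most 12K ≤ κN, which raises 8κ to 9κ.
    bound≤ : ∀ k → k ≤ N → ι 12 * ι K ≤ℚ κ * ι N → bound k 0 ≤ℚ (1ℚ + ι 9 * κ) * ι N
    bound≤ k k≤N = lemma (ι-mono-≤ k N k≤N) (ι-mono-≤ (K ∸ 1) K (ℕ.m∸n≤m K 1))
      where
      lemma : ∀ {a b c t} → b ≤ℚ t → c ≤ℚ a → ι 12 * a ≤ℚ κ * t → ι 4 * a + ((1ℚ + ι 8 * κ) * b + ι 8 * c) ≤ℚ (1ℚ + ι 9 * κ) * t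
      lemma {a} {b} {c} {t} b≤t c≤a 12a≤κt = ≤-by-gap
        (0≤-+ (p≤q⇒0≤q-p 12a≤κt) (0≤-+ (0≤-* (0≤ι 8) (p≤q⇒0≤q-p c≤a)) (0≤-* 0≤hi (p≤q⇒0≤q-p b≤t))))
        (solve (a ∷ b ∷ c ∷ t ∷ κ ∷ []) ℚ-ring)

-- From u back to R_N(1), and the choice of K.

≤-multiple⇒ : ∀ {κ k x y} → 0ℚ ≤ℚ κ → κ * k ≡ 1ℚ → k * x ≤ℚ y → x ≤ℚ κ * y
≤-multiple⇒ {κ} {k} {x} {y} 0≤κ κk≡1 kx≤y = subst (_≤ℚ κ * y)
  (trans (sym (*-assoc κ k x)) (trans (cong (_* x) κk≡1) (*-identityˡ x)))
  (*-monoˡ {κ} 0≤κ kx≤y)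

p<p+1 : ∀ p → p < p + 1ℚ
p<p+1 p = subst (_< p + 1ℚ) (+-identityʳ p) (+-monoʳ-< p (positive⁻¹ 1ℚ))

module _ {κ ε t u x M : ℚ} (0≤κ : 0ℚ ≤ℚ κ) (12κ≤1 : ι 12 * κ ≤ℚ 1ℚ) (12κ≤ε : ι 12 * κ ≤ℚ ε)
         (1≤t : 1ℚ ≤ℚ t) (M≡t+1 : M ≡ t + 1ℚ) (x≡Mu : x ≡ M * u) where

  private
    0≤t : 0ℚ ≤ℚ t
    0≤t = ≤-trans 0≤1 1≤t
    0≤M : 0ℚ ≤ℚ M
    0≤M = subst (0ℚ ≤ℚ_) (sym M≡t+1) (0≤-+ 0≤t 0≤1)
    0≤ε : 0ℚ ≤ℚ ε
    0≤ε = ≤-trans (0≤-* (0≤ι 12) 0≤κ) 12κ≤ε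
    xx*≡ : ∀ b → x * x * b ≡ M * M * (u * u * b)
    xx*≡ b = trans (cong (λ z → z * z * b) x≡Mu) (solve (M ∷ u ∷ b ∷ []) ℚ-ring)

  -- Used with t = N, M = N + 1, x = R_N(1). If the claim failed, x²b would be at most (1 - ε)²(1 +
  -- 9κ)t² ≤ t², whereas u²b ≥ 1 forces x²b ≥ M² > t².
  square-> : ∀ {b} → 0ℚ ≤ℚ b → b ≤ℚ (1ℚ + ι 9 * κ) * t → 1ℚ ≤ℚ u * u * b → 0ℚ ≤ℚ 1ℚ - ε →
             ((1ℚ - ε) * (1ℚ - ε)) * t < x * x
  square-> {b} 0≤b b≤ 1≤uub 0≤1-ε = ≰⇒> λ xx≤ → <-irrefl refl (<-≤-trans tt<MM (≤-trans MM≤xxb (≤-trans (*-monoʳ {b} 0≤b xx≤) small)))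
    where
    tt<MM : t * t < M * M
    tt<MM = subst (λ z → t * t < z * z) (sym M≡t+1) (<-≤-trans (p<p+1 (t * t)) (≤-by-gap (0≤-* (0≤ι 2) 0≤t) (solve (t ∷ []) ℚ-ring)))
    MM≤xxb : M * M ≤ℚ x * x * b
    MM≤xxb = subst (M * M ≤ℚ_) (sym (xx*≡ b)) (≤-trans (≤-reflexive (sym (*-identityʳ (M * M)))) (*-monoˡ {M * M} (0≤-* 0≤M 0≤M) 1≤uub))
    -- By ε ≥ 12κ, (1 - ε)(1 + 9κ) ≤ (1 - 12κ)(1 + 9κ) = 1 - 3κ - 108κ².
    factor≤1 : ((1ℚ - ε) * (1ℚ - ε)) * (1ℚ + ι 9 * κ) ≤ℚ 1ℚ
    factor≤1 = ≤-by-gap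
      (0≤-+ 0≤ε (0≤-* 0≤1-ε (0≤-+ (0≤-+ (0≤-* (0≤ι 3) 0≤κ) (0≤-* (0≤ι 108) (0≤-* 0≤κ 0≤κ)))
        (0≤-* (0≤-+ 0≤1 (0≤-* (0≤ι 9) 0≤κ)) (p≤q⇒0≤q-p 12κ≤ε)))))
      (solve (κ ∷ ε ∷ []) ℚ-ring)
    small : ((1ℚ - ε) * (1ℚ - ε)) * t * b ≤ℚ t * t
    small = ≤-by-gap (0≤-+ (0≤-* (0≤-* (0≤-* 0≤1-ε 0≤1-ε) 0≤t) (p≤q⇒0≤q-p b≤)) (0≤-* (0≤-* 0≤t 0≤t) (p≤q⇒0≤q-p factor≤1)))
      (solve (κ ∷ ε ∷ t ∷ b ∷ []) ℚ-ring)

  -- If the claim failed, M² ≥ x²(1 - 2κ)(1 - κ)t ≥ (1 + 15κ)t² ≥ (t + 1)² + 1 = M² + 1.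
  square-< : 1ℚ ≤ℚ κ * t → u * u * ((1ℚ - ι 2 * κ) * (1ℚ - κ) * t) ≤ℚ 1ℚ →
             x * x < ((1ℚ + ε) * (1ℚ + ε)) * t
  square-< 1≤κt uub≤1 = ≰⇒> λ ≤xx → <-irrefl refl (<-≤-trans (p<p+1 (M * M)) (≤-trans large (≤-trans (*-monoʳ {(1ℚ - ι 2 * κ) * (1ℚ - κ) * t} (0≤-* (0≤-* 0≤lo 0≤1-κ) 0≤t) ≤xx) xxb≤MM)))
    where
    0≤lo : 0ℚ ≤ℚ 1ℚ - ι 2 * κ
    0≤lo = ≤-trans (0≤-+ (p≤q⇒0≤q-p 12κ≤1) (0≤-* (0≤ι 10) 0≤κ)) (≤-reflexive (solve (κ ∷ []) ℚ-ring))
    0≤1-κ : 0ℚ ≤ℚ 1ℚ - κ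
    0≤1-κ = ≤-trans (0≤-+ 0≤lo 0≤κ) (≤-reflexive (solve (κ ∷ []) ℚ-ring))
    xxb≤MM : x * x * ((1ℚ - ι 2 * κ) * (1ℚ - κ) * t) ≤ℚ M * M
    xxb≤MM = subst (_≤ℚ M * M) (sym (xx*≡ ((1ℚ - ι 2 * κ) * (1ℚ - κ) * t))) (≤-trans (*-monoˡ {M * M} (0≤-* 0≤M 0≤M) uub≤1) (≤-reflexive (*-identityʳ (M * M))))
    -- (1 + ε)² ≥ 1 + 24κ, and (1 + 24κ)(1 - 3κ + 2κ²) exceeds 1 + 15κ by κ(6 - 70κ + 48κ²).
    factor≥ : 1ℚ + ι 15 * κ ≤ℚ ((1ℚ + ε) * (1ℚ + ε)) * ((1ℚ - ι 2 * κ) * (1ℚ - κ))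
    factor≥ = ≤-by-gap
      (0≤-+ (0≤-* (0≤-* 0≤lo 0≤1-κ) (0≤-+ (0≤-* 0≤ε 0≤ε) (0≤-* (0≤ι 2) (p≤q⇒0≤q-p 12κ≤ε))))
        (0≤-* 0≤κ (0≤-+ (0≤-* (0≤ι 6) (p≤q⇒0≤q-p 12κ≤1)) (0≤-+ (0≤-* (0≤ι 2) 0≤κ) (0≤-* (0≤ι 48) (0≤-* 0≤κ 0≤κ))))))
      (solve (κ ∷ ε ∷ []) ℚ-ring)
    -- κt ≥ 1 makes 15κt² at least 15t, which covers 2t + 2.
    sq+1≤ : (t + 1ℚ) * (t + 1ℚ) + 1ℚ ≤ℚ ((1ℚ + ε) * (1ℚ + ε)) * t * ((1ℚ - ι 2 * κ) * (1ℚ - κ) * t)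
    sq+1≤ = ≤-by-gap
      (0≤-+ (0≤-* (0≤-* 0≤t 0≤t) (p≤q⇒0≤q-p factor≥)) (0≤-+ (0≤-* (0≤-* (0≤ι 15) 0≤t) (p≤q⇒0≤q-p 1≤κt))
        (0≤-+ (0≤-* (0≤ι 2) (p≤q⇒0≤q-p 1≤t)) (0≤-* (0≤ι 11) 0≤t))))
      (solve (κ ∷ ε ∷ t ∷ []) ℚ-ring)
    large : M * M + 1ℚ ≤ℚ ((1ℚ + ε) * (1ℚ + ε)) * t * ((1ℚ - ι 2 * κ) * (1ℚ - κ) * t)
    large = subst (λ z → z * z + 1ℚ ≤ℚ ((1ℚ + ε) * (1ℚ + ε)) * t * ((1ℚ - ι 2 * κ) * (1ℚ - κ) * t)) (sym M≡t+1) sq+1≤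

-- The limit is stated with squares to avoid roots; for ε ≥ 1 the lower estimate is covered by the
-- first alternative.
theorem1 : (ε : ℚ) → 0ℚ < ε →
    ∃[ N₀ ] ((N : ℕ) → N₀ ≤ N → 2 ≤ N →
    ((1ℚ - ε ≤ℚ 0ℚ) ⊎ ((1ℚ - ε) * (1ℚ - ε)) * ((+ N) / 1) < R N 1 * R N 1)
    × (R N 1 * R N 1 < ((1ℚ + ε) * (1ℚ + ε)) * ((+ N) / 1)))
theorem1 (mkℚ (+ zero) _ _) (*<* (ℤ.+<+ ()))
theorem1 (mkℚ -[1+ _ ] _ _) (*<* ())
-- K is 12(d + 1), written as a successor for `recip`; as ε ≥ 1/(d + 1), this gives 12κ ≤ ε. In the
-- threshold, K⁴ provides κ⁴N ≥ 1 and 12K² provides κN ≥ 12K.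
theorem1 ε@(mkℚ (+ suc e) d _) _ = K ℕ.* (K ℕ.* (K ℕ.* K)) ℕ.+ K ℕ.* (12 ℕ.* K) , go
  where
  K : ℕ
  K = suc (d ℕ.+ 11 ℕ.* suc d)
  κ : ℚ
  κ = recip (d ℕ.+ 11 ℕ.* suc d)
  κK≡1 : κ * ι K ≡ 1ℚ
  κK≡1 = recip-inverse (d ℕ.+ 11 ℕ.* suc d)
  0≤κ : 0ℚ ≤ℚ κ
  0≤κ = *-cancelˡ {ι K} {0ℚ} {κ} (0<ι-suc (d ℕ.+ 11 ℕ.* suc d)) (≤-trans (≤-reflexive (*-zeroʳ (ι K))) (≤-trans 0≤1 (≤-reflexive (sym (trans (*-comm (ι K) κ) κK≡1)))))
  12κ≤ : ∀ {z} → ι 12 ≤ℚ ι K * z → ι 12 * κ ≤ℚ z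
  12κ≤ {z} 12≤Kz = *-cancelˡ {ι K} (0<ι-suc (d ℕ.+ 11 ℕ.* suc d))
    (≤-trans (≤-reflexive (trans (rearrange (ι K)) (cong (ι 12 *_) κK≡1))) (≤-trans (≤-reflexive (*-identityʳ (ι 12))) 12≤Kz))
    where
    rearrange : ∀ k → k * (ι 12 * κ) ≡ ι 12 * (κ * k)
    rearrange k = trans (sym (*-assoc k (ι 12) κ)) (trans (cong (_* κ) (*-comm k (ι 12))) (trans (*-assoc (ι 12) k κ) (cong (ι 12 *_) (*-comm k κ))))
  12≤K : 12 ≤ K
  12≤K = ℕ.m≤m*n 12 (suc d)
  12κ≤1 : ι 12 * κ ≤ℚ 1ℚ
  12κ≤1 = 12κ≤ (≤-trans (ι-mono-≤ 12 K 12≤K) (≤-reflexive (sym (*-identityʳ (ι K)))))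
  ε*d : ε * ι (suc d) ≡ ι (suc e)
  ε*d = trans (cong (_* ι (suc d)) (sym (↥p/↧p≡p ε))) (/-cancel (+ suc e) d)
  12κ≤ε : ι 12 * κ ≤ℚ ε
  12κ≤ε = 12κ≤ (≤-trans (≤-trans (≤-reflexive (sym (*-identityʳ (ι 12)))) (*-monoˡ {ι 12} (0≤ι 12) (1≤ι-suc e)))
    (≤-reflexive (sym (trans (cong (_* ε) (ι-homo-* 12 (suc d))) (trans (*-assoc (ι 12) (ι (suc d)) ε) (cong (ι 12 *_) (trans (*-comm (ι (suc d)) ε) ε*d)))))))
  go : (N : ℕ) → K ℕ.* (K ℕ.* (K ℕ.* K)) ℕ.+ K ℕ.* (12 ℕ.* K) ≤ N → 2 ≤ N →
    ((1ℚ - ε ≤ℚ 0ℚ) ⊎ ((1ℚ - ε) * (1ℚ - ε)) * ((+ N) / 1) < R N 1 * R N 1)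
    × (R N 1 * R N 1 < ((1ℚ + ε) * (1ℚ + ε)) * ((+ N) / 1))
  -- Round 1 is reached after m = N - 1 steps.
  go N@(suc m) N₀≤N _ = lower (≤-total (1ℚ - ε) 0ℚ) ,
      square-< 0≤κ 12κ≤1 12κ≤ε (1≤ι-suc m) (ι-suc N) x≡Mu 1≤κN (uu*target≤1 N K κ κK≡1 0≤κ 12κ≤1 m (ℕ.+-comm m 1) 1≤κN 1≤κ⁴N)
    where
    u : ℚ
    u = scaled N m
    x≡Mu : R N 1 ≡ ι (suc N) * u
    x≡Mu = trans (sym (*-identityˡ (R N 1))) (trans (cong (_* R N 1) (sym (trans (*-comm (ι (suc N)) (recip N)) (recip-inverse N)))) (*-assoc (ι (suc N)) (recip N) (R N 1)))
    12K≤κN : ι (12 ℕ.* K) ≤ℚ κ * ι N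
    12K≤κN = ≤-multiple⇒ 0≤κ κK≡1 (≤-trans (≤-reflexive (sym (ι-homo-* K (12 ℕ.* K))))
      (ι-mono-≤ (K ℕ.* (12 ℕ.* K)) N (ℕ.≤-trans (ℕ.m≤n+m (K ℕ.* (12 ℕ.* K)) (K ℕ.* (K ℕ.* (K ℕ.* K)))) N₀≤N)))
    1≤κN : 1ℚ ≤ℚ κ * ι N
    1≤κN = ≤-trans (ι-mono-≤ 1 (12 ℕ.* K) (ℕ.s≤s ℕ.z≤n)) 12K≤κN
    1≤κ⁴N : 1ℚ ≤ℚ κ * (κ * (κ * (κ * ι N)))
    1≤κ⁴N = ≤-multiple⇒ 0≤κ κK≡1 (≤-trans (≤-reflexive (*-identityʳ (ι K)))
      (≤-multiple⇒ 0≤κ κK≡1 (≤-multiple⇒ 0≤κ κK≡1 (≤-multiple⇒ 0≤κ κK≡1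
        (≤-trans (≤-reflexive (sym (trans (ι-homo-* K (K ℕ.* (K ℕ.* K))) (cong (ι K *_) (trans (ι-homo-* K (K ℕ.* K)) (cong (ι K *_) (ι-homo-* K K)))))))
          (ι-mono-≤ (K ℕ.* (K ℕ.* (K ℕ.* K))) N (ℕ.≤-trans (ℕ.m≤m+n (K ℕ.* (K ℕ.* (K ℕ.* K))) (K ℕ.* (12 ℕ.* K))) N₀≤N)))))))
    lower : 1ℚ - ε ≤ℚ 0ℚ ⊎ 0ℚ ≤ℚ 1ℚ - ε → (1ℚ - ε ≤ℚ 0ℚ) ⊎ ((1ℚ - ε) * (1ℚ - ε)) * ι N < R N 1 * R N 1
    lower (inj₁ p) = inj₁ p
    lower (inj₂ p) = inj₂ (square-> 0≤κ 12κ≤1 12κ≤ε (1≤ι-suc m) (ι-suc N) x≡Mu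
      (0≤bound N K κ κK≡1 0≤κ 12κ≤1 m 0) (bound≤ N K κ κK≡1 0≤κ 12κ≤1 m (ℕ.n≤1+n m) (subst (_≤ℚ κ * ι N) (ι-homo-* 12 K) 12K≤κN)) (1≤uu*bound N K κ κK≡1 0≤κ 12κ≤1 m 0 (ℕ.+-comm m 1)) p)
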